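{- Let $G=(V,E)$ be a finite simple undirected graph with chromatic number $\chi(G)$, let $q(G)=\chi(G)-1$, and let $\kappa$ be a positive integer with $\kappa\le q(G)$. If $(\bar w,\bar z)$ is a feasible solution to $AO(G,\kappa)$, then $\bar z=\kappa$.
   Context: Let $m=|E|$. Let $D=(V,A)$ be the directed graph with $A=\{(i,j),(j,i)\mid [i,j]\in E\}$. Paths are directed and elementary (no repeated vertices); paths and cycles are identified with their arc sets. $P_\kappa(A)$ denotes the set of all paths in $D$ with exactly $\kappa$ arcs, and $C(A)$ the set of all directed (elementary) cycles in $D$, with $|C|$ the number of arcs of $C$. The problem $AO(G,\kappa)$, in variables $(w,z)\in\mathbb{R}^{2m}\times\mathbb{R}$ with $w=(w_{ij})_{(i,j)\in A}$, is: minimize $z$ subject to (1) $w_{ij}+w_{ji}=1$ for all $[i,j]\in E$; (2) $\sum_{(i,j)\in C}w_{ij}\le |C|-1$ for all $C\in C(A)$; (3) $\sum_{(i,j)\in p}w_{ij}\le z$ for all $p\in P_\kappa(A)$; (4) $w_{ij}\in\{0,1\}$ for all $(i,j)\in A$; (5) $0\le z\le\kappa$. A feasible solution is a pair $(w,z)$ satisfying (1)--(5). By a known theorem (Roy, Gallai, Deming), $q(G)=\chi(G)-1$ equals the minimum, over all acyclic orientations $\omega$ of $G$, of the number of arcs in a longest directed path of the oriented graph $G_\omega$. -}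

module Defs where

open import Algebra.Bundles using (CommutativeMonoid)
open import Data.Bool.Base using (Bool; T)
open import Data.Fin.Base using (Fin)
open import Data.Integer.Base using (+_)
open import Data.List.Base using (List; []; _∷_; map; foldr; length)
open import Data.List.Relation.Unary.Unique.Propositional using (Unique)
open import Data.Nat.Base as ℕ using (ℕ; suc; _∸_)
import Data.Nat.Properties as ℕₚ
open import Data.Product.Base using (∃-syntax; Σ-syntax; _,_)
open import Data.Rational.Base as ℚ using (ℚ; 0ℚ; ½; ∣_∣)
import Data.Rational.Properties as ℚₚ
open import Data.Sum.Base using (_⊎_)
open import Relation.Binary.PropositionalEquality using (_≡_; _≢_; sym; trans; cong; subst)
open import Relation.Nullary using (¬_)

-- ℝ is the setoid of Cauchy sequences of rationals, two sequences being
-- equal when their difference tends to 0.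

record ℝ : Set where
  constructor mkℝ
  field
    seq    : ℕ → ℚ
    cauchy : ∀ ε → 0ℚ ℚ.< ε →
             ∃[ N ] ∀ m n → N ℕ.≤ m → N ℕ.≤ n → ∣ seq m ℚ.- seq n ∣ ℚ.< ε

open ℝ public

infix  4 _≃_ _≤ᴿ_
infixl 6 _+ᴿ_

_≃_ : ℝ → ℝ → Set
x ≃ y = ∀ ε → 0ℚ ℚ.< ε → ∃[ N ] ∀ n → N ℕ.≤ n → ∣ seq x n ℚ.- seq y n ∣ ℚ.< ε

_≤ᴿ_ : ℝ → ℝ → Set
x ≤ᴿ y = ∀ ε → 0ℚ ℚ.< ε → ∃[ N ] ∀ n → N ℕ.≤ n → seq x n ℚ.< seq y n ℚ.+ ε

fromℚ : ℚ → ℝ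
fromℚ q = mkℝ (λ _ → q) λ ε 0<ε → 0 , λ _ _ _ _ →
  subst (ℚ._< ε) (sym (cong ∣_∣ (ℚₚ.+-inverseʳ q))) 0<ε

fromℕ : ℕ → ℝ
fromℕ k = fromℚ (+ k ℚ./ 1)

0ᴿ 1ᴿ : ℝ
0ᴿ = fromℕ 0
1ᴿ = fromℕ 1

private
  0<½ε : ∀ {ε} → 0ℚ ℚ.< ε → 0ℚ ℚ.< ½ ℚ.* ε
  0<½ε {ε} 0<ε = subst (ℚ._< ½ ℚ.* ε) (ℚₚ.*-zeroʳ ½) (ℚₚ.*-monoʳ-<-pos ½ 0<ε)

  ½ε+½ε : ∀ ε → ½ ℚ.* ε ℚ.+ ½ ℚ.* ε ≡ ε
  ½ε+½ε ε = trans (sym (ℚₚ.*-distribʳ-+ ε ½ ½)) (ℚₚ.*-identityˡ ε)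

  −-interchange : ∀ a b c d → (a ℚ.+ b) ℚ.- (c ℚ.+ d) ≡ (a ℚ.- c) ℚ.+ (b ℚ.- d)
  −-interchange a b c d =
    trans (cong ((a ℚ.+ b) ℚ.+_) (ℚₚ.neg-distrib-+ c d)) (interchange a b (ℚ.- c) (ℚ.- d))
    where open import Algebra.Properties.CommutativeSemigroup
           (CommutativeMonoid.commutativeSemigroup ℚₚ.+-0-commutativeMonoid) using (interchange)

_+ᴿ_ : ℝ → ℝ → ℝ
x +ᴿ y = mkℝ (λ n → seq x n ℚ.+ seq y n) λ ε 0<ε →
  let N₁ , close₁ = cauchy x (½ ℚ.* ε) (0<½ε 0<ε)
      N₂ , close₂ = cauchy y (½ ℚ.* ε) (0<½ε 0<ε)
  in N₁ ℕ.⊔ N₂ , λ m n N≤m N≤n →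
    let open ℚₚ.≤-Reasoning
        xm = seq x m ; xn = seq x n ; ym = seq y m ; yn = seq y n
    in begin-strict
      ∣ (xm ℚ.+ ym) ℚ.- (xn ℚ.+ yn) ∣    ≡⟨ cong ∣_∣ (−-interchange xm ym xn yn) ⟩
      ∣ (xm ℚ.- xn) ℚ.+ (ym ℚ.- yn) ∣    ≤⟨ ℚₚ.∣p+q∣≤∣p∣+∣q∣ (xm ℚ.- xn) (ym ℚ.- yn) ⟩
      ∣ xm ℚ.- xn ∣ ℚ.+ ∣ ym ℚ.- yn ∣    <⟨ ℚₚ.+-mono-<
        (close₁ m n (ℕₚ.m⊔n≤o⇒m≤o N₁ N₂ N≤m) (ℕₚ.m⊔n≤o⇒m≤o N₁ N₂ N≤n))
        (close₂ m n (ℕₚ.m⊔n≤o⇒n≤o N₁ N₂ N≤m) (ℕₚ.m⊔n≤o⇒n≤o N₁ N₂ N≤n)) ⟩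
      ½ ℚ.* ε ℚ.+ ½ ℚ.* ε                ≡⟨ ½ε+½ε ε ⟩
      ε                                  ∎

∑ : List ℝ → ℝ
∑ = foldr _+ᴿ_ 0ᴿ

-- The adjacency matrix is Boolean so that adjacency of two given vertices has
-- at most one proof; an arc is then determined by its endpoints.

record Graph (n : ℕ) : Set where
  field
    adj      : Fin n → Fin n → Bool
    adj-sym  : ∀ {i j} → T (adj i j) → T (adj j i)
    loopless : ∀ {i} → ¬ T (adj i i)

  Adj : Fin n → Fin n → Set
  Adj i j = T (adj i j)

Colourable : ∀ {n} → Graph n → ℕ → Set
Colourable {n} G k =
  Σ[ c ∈ (Fin n → Fin k) ] (∀ i j → Graph.Adj G i j → c i ≢ c j)

record IsChromaticNumber {n} (G : Graph n) (χ : ℕ) : Set where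
  field
    colourable : Colourable G χ
    least      : ∀ k → Colourable G k → χ ℕ.≤ k

module _ {n} (G : Graph n) where
  open Graph G

  record Arc : Set where
    constructor arc
    field
      tail head : Fin n
      adjacent  : Adj tail head

  data Walk : Fin n → Fin n → ℕ → Set where
    []  : ∀ {i} → Walk i i 0
    _∷_ : ∀ {i j k ℓ} → Adj i j → Walk j k ℓ → Walk i k (suc ℓ)

module _ {n} {G : Graph n} where

  reverse : Arc G → Arc G
  reverse (arc i j ij) = arc j i (Graph.adj-sym G ij)

  walkArcs : ∀ {i j ℓ} → Walk G i j ℓ → List (Arc G)
  walkArcs []               = []
  walkArcs (_∷_ {i} {j} e p) = arc i j e ∷ walkArcs p

  walkVertices : ∀ {i j ℓ} → Walk G i j ℓ → List (Fin n)
  walkVertices {i} []      = i ∷ []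
  walkVertices {i} (_ ∷ p) = i ∷ walkVertices p

record Path {n} (G : Graph n) (κ : ℕ) : Set where
  field
    {source target} : Fin n
    walk            : Walk G source target κ
    elementary      : Unique (walkVertices walk)

  arcs : List (Arc G)
  arcs = walkArcs walk

-- A cycle is represented by a closed walk from an arbitrary one of its
-- vertices; each vertex of the cycle is the tail of exactly one arc.  A pair of
-- opposite arcs is a cycle with two arcs.

record Cycle {n} (G : Graph n) : Set where
  field
    {root}     : Fin n
    {ℓ}        : ℕ
    walk       : Walk G root root (suc ℓ)
    elementary : Unique (map Arc.tail (walkArcs walk))

  arcs : List (Arc G)
  arcs = walkArcs walk

record Feasible {n} (G : Graph n) (κ : ℕ) (w : Arc G → ℝ) (z : ℝ) : Set where
  field
    orientation : ∀ a → w a +ᴿ w (reverse a) ≃ 1ᴿ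
    acyclic     : ∀ (C : Cycle G) →
                  ∑ (map w (Cycle.arcs C)) ≤ᴿ fromℕ (length (Cycle.arcs C) ∸ 1)
    pathBound   : ∀ (p : Path G κ) → ∑ (map w (Path.arcs p)) ≤ᴿ z
    binary      : ∀ a → w a ≃ 0ᴿ ⊎ w a ≃ 1ᴿ
    z-lower     : 0ᴿ ≤ᴿ z
    z-upper     : z ≤ᴿ fromℕ κ

{-# OPTIONS --safe #-}
-- Orient each edge along its arc of weight 1.  If no walk of κ such arcs
-- existed, colouring every vertex by the length of a longest walk leaving it
-- would be a proper colouring with κ ≤ χ − 1 colours.  So there is such a walk;
-- by the cycle constraints it is elementary, and its path constraint reads κ ≤ z.
module Submission where

open import Defs
open import Algebra.Bundles using (AbelianGroup)
open import Data.Bool.Properties using (T?; T-irrelevant)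
open import Data.Empty using (⊥-elim)
open import Data.Fin.Base using (Fin; fromℕ<)
open import Data.Fin.Properties using (any?; fromℕ<-injective)
open import Data.Integer.Base as ℤ using (+_)
import Data.Integer.Properties as ℤₚ
open import Data.List.Base using (List; []; _∷_; map; length)
open import Data.List.Membership.Propositional using (_∈_)
open import Data.List.Relation.Binary.Sublist.Propositional using (_⊆_; []; _∷_; _∷ʳ_; minimum; ⊆-trans)
open import Data.List.Relation.Binary.Sublist.Propositional.Properties
  using (map⁺; All-resp-⊆)
open import Data.List.Relation.Unary.All as All using (All; []; _∷_)
open import Data.List.Relation.Unary.All.Properties using (¬Any⇒All¬)
open import Data.List.Relation.Unary.AllPairs using ([]; _∷_)
open import Data.List.Relation.Unary.Any using (here; there)
open import Data.List.Relation.Unary.Unique.Propositional using (Unique)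
open import Data.Nat.Base as ℕ using (ℕ; zero; suc; _≤_; _∸_; _⊔_)
open import Data.Nat.Coprimality as Coprimality using (1-coprimeTo)
import Data.Nat.Properties as ℕₚ
open import Data.Product.Base using (∃-syntax; Σ-syntax; _×_; _,_; proj₁; proj₂)
open import Data.Rational.Base as ℚ using (ℚ; mkℚ; 0ℚ; 1ℚ; ½; ∣_∣)
import Data.Rational.Properties as ℚₚ
open import Data.Sum.Base using (_⊎_; inj₁; inj₂; [_,_]′)
open import Data.Unit.Base using (tt)
open import Function.Base using (_∘_)
open import Relation.Binary.PropositionalEquality
  using (_≡_; _≢_; refl; sym; trans; cong; subst; ≢-sym)
open import Relation.Nullary using (¬_; Dec; yes; no)
open import Relation.Nullary.Decidable using (map′; _×-dec_; toWitness)
open import Relation.Nullary.Negation using (contradiction)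
open import Relation.Unary using (Decidable)

open import Algebra.Properties.CommutativeSemigroup
  (AbelianGroup.commutativeSemigroup ℚₚ.+-0-abelianGroup) using (interchange)
open import Algebra.Properties.Group
  (AbelianGroup.group ℚₚ.+-0-abelianGroup) using (//-rightDividesˡ; //-rightDividesʳ; ⁻¹-anti-homo-//)

-- Inequalities and absolute values of rationals.

p-q<r⇒p<q+r : ∀ {p q r} → p ℚ.- q ℚ.< r → p ℚ.< q ℚ.+ r
p-q<r⇒p<q+r {p} {q} {r} lt = begin-strict
  p                   ≡⟨ //-rightDividesˡ q p ⟨
  (p ℚ.- q) ℚ.+ q     <⟨ ℚₚ.+-monoˡ-< q lt ⟩
  r ℚ.+ q             ≡⟨ ℚₚ.+-comm r q ⟩
  q ℚ.+ r             ∎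
  where open ℚₚ.≤-Reasoning

p<q+r⇒p-q<r : ∀ {p q r} → p ℚ.< q ℚ.+ r → p ℚ.- q ℚ.< r
p<q+r⇒p-q<r {p} {q} {r} lt = begin-strict
  p ℚ.- q             <⟨ ℚₚ.+-monoˡ-< (ℚ.- q) lt ⟩
  (q ℚ.+ r) ℚ.- q     ≡⟨ cong (ℚ._- q) (ℚₚ.+-comm q r) ⟩
  (r ℚ.+ q) ℚ.- q     ≡⟨ //-rightDividesʳ q r ⟩
  r                   ∎
  where open ℚₚ.≤-Reasoning

∣p-q∣≡∣q-p∣ : ∀ p q → ∣ p ℚ.- q ∣ ≡ ∣ q ℚ.- p ∣
∣p-q∣≡∣q-p∣ p q = trans (sym (ℚₚ.∣-p∣≡∣p∣ (p ℚ.- q))) (cong ∣_∣ (⁻¹-anti-homo-// p q))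

p≤∣p∣ : ∀ p → p ℚ.≤ ∣ p ∣
p≤∣p∣ p with ℚₚ.≤-total 0ℚ p
... | inj₁ 0≤p = ℚₚ.≤-reflexive (sym (ℚₚ.0≤p⇒∣p∣≡p 0≤p))
... | inj₂ p≤0 = ℚₚ.≤-trans p≤0 (ℚₚ.0≤∣p∣ p)

∣p-q∣<r : ∀ {p q r} → p ℚ.< q ℚ.+ r → q ℚ.< p ℚ.+ r → ∣ p ℚ.- q ∣ ℚ.< r
∣p-q∣<r {p} {q} {r} p< q< with ℚₚ.∣p∣≡p∨∣p∣≡-p (p ℚ.- q)
... | inj₁ eq = subst (ℚ._< r) (sym eq) (p<q+r⇒p-q<r p<)
... | inj₂ eq = subst (ℚ._< r) (sym (trans eq (⁻¹-anti-homo-// p q))) (p<q+r⇒p-q<r q<)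

0<½p : ∀ {p} → 0ℚ ℚ.< p → 0ℚ ℚ.< ½ ℚ.* p
0<½p {p} 0<p = subst (ℚ._< ½ ℚ.* p) (ℚₚ.*-zeroʳ ½) (ℚₚ.*-monoʳ-<-pos ½ 0<p)

½p+½p : ∀ p → ½ ℚ.* p ℚ.+ ½ ℚ.* p ≡ p
½p+½p p = trans (sym (ℚₚ.*-distribʳ-+ p ½ ½)) (ℚₚ.*-identityˡ p)

-- For a variable k the division normalises through a gcd that does not compute; the fraction
-- written in lowest terms lets the sum in `1+k/1` unfold.
k/1 : ∀ k → + k ℚ./ 1 ≡ mkℚ (+ k) 0 (Coprimality.sym (1-coprimeTo k))
k/1 k = ℚₚ.normalize-coprime (Coprimality.sym (1-coprimeTo k))

1+k/1 : ∀ k → 1ℚ ℚ.+ + k ℚ./ 1 ≡ + suc k ℚ./ 1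
1+k/1 k = trans (cong (1ℚ ℚ.+_) (k/1 k))
  (cong (λ i → (+ 1 ℤ.+ i) ℚ./ 1) (ℤₚ.*-identityʳ (+ k)))

-- Order and addition of Cauchy reals.

≃⇒≤ᴿ : ∀ {x y} → x ≃ y → x ≤ᴿ y
≃⇒≤ᴿ {x} {y} x≃y ε 0<ε = let N , close = x≃y ε 0<ε in
  N , λ n N≤n → p-q<r⇒p<q+r (ℚₚ.≤-<-trans (p≤∣p∣ (seq x n ℚ.- seq y n)) (close n N≤n))

≃⇒≥ᴿ : ∀ {x y} → x ≃ y → y ≤ᴿ x
≃⇒≥ᴿ {x} {y} x≃y = ≃⇒≤ᴿ {y} {x} λ ε 0<ε → let N , close = x≃y ε 0<ε in
  N , λ n N≤n → subst (ℚ._< ε) (∣p-q∣≡∣q-p∣ (seq x n) (seq y n)) (close n N≤n)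

≤ᴿ-antisym : ∀ {x y} → x ≤ᴿ y → y ≤ᴿ x → x ≃ y
≤ᴿ-antisym {x} {y} x≤y y≤x ε 0<ε =
  let M , below = x≤y ε 0<ε
      N , above = y≤x ε 0<ε
  in M ⊔ N , λ n M⊔N≤n →
    ∣p-q∣<r (below n (ℕₚ.m⊔n≤o⇒m≤o M N M⊔N≤n)) (above n (ℕₚ.m⊔n≤o⇒n≤o M N M⊔N≤n))

≤ᴿ-trans : ∀ {x y z} → x ≤ᴿ y → y ≤ᴿ z → x ≤ᴿ z
≤ᴿ-trans {x} {y} {z} x≤y y≤z ε 0<ε =
  let M , below = x≤y (½ ℚ.* ε) (0<½p 0<ε)
      N , above = y≤z (½ ℚ.* ε) (0<½p 0<ε)
  in M ⊔ N , λ n M⊔N≤n → let open ℚₚ.≤-Reasoning in begin-strict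
    seq x n                                  <⟨ below n (ℕₚ.m⊔n≤o⇒m≤o M N M⊔N≤n) ⟩
    seq y n ℚ.+ ½ ℚ.* ε                      <⟨ ℚₚ.+-monoˡ-< (½ ℚ.* ε)
                                                  (above n (ℕₚ.m⊔n≤o⇒n≤o M N M⊔N≤n)) ⟩
    (seq z n ℚ.+ ½ ℚ.* ε) ℚ.+ ½ ℚ.* ε        ≡⟨ ℚₚ.+-assoc (seq z n) (½ ℚ.* ε) (½ ℚ.* ε) ⟩
    seq z n ℚ.+ (½ ℚ.* ε ℚ.+ ½ ℚ.* ε)        ≡⟨ cong (seq z n ℚ.+_) (½p+½p ε) ⟩
    seq z n ℚ.+ ε                            ∎

+ᴿ-mono-≤ᴿ : ∀ {x x′ y y′} → x ≤ᴿ x′ → y ≤ᴿ y′ → x +ᴿ y ≤ᴿ x′ +ᴿ y′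
+ᴿ-mono-≤ᴿ {x} {x′} {y} {y′} x≤x′ y≤y′ ε 0<ε =
  let M , close₁ = x≤x′ (½ ℚ.* ε) (0<½p 0<ε)
      N , close₂ = y≤y′ (½ ℚ.* ε) (0<½p 0<ε)
  in M ⊔ N , λ n M⊔N≤n → let open ℚₚ.≤-Reasoning in begin-strict
    seq x n ℚ.+ seq y n
      <⟨ ℚₚ.+-mono-< (close₁ n (ℕₚ.m⊔n≤o⇒m≤o M N M⊔N≤n))
                     (close₂ n (ℕₚ.m⊔n≤o⇒n≤o M N M⊔N≤n)) ⟩
    (seq x′ n ℚ.+ ½ ℚ.* ε) ℚ.+ (seq y′ n ℚ.+ ½ ℚ.* ε)
      ≡⟨ interchange (seq x′ n) (½ ℚ.* ε) (seq y′ n) (½ ℚ.* ε) ⟩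
    (seq x′ n ℚ.+ seq y′ n) ℚ.+ (½ ℚ.* ε ℚ.+ ½ ℚ.* ε)
      ≡⟨ cong ((seq x′ n ℚ.+ seq y′ n) ℚ.+_) (½p+½p ε) ⟩
    (seq x′ n ℚ.+ seq y′ n) ℚ.+ ε
      ∎

fromℕ-suc : ∀ k → fromℕ (suc k) ≤ᴿ 1ᴿ +ᴿ fromℕ k
fromℕ-suc k ε 0<ε = 0 , λ _ _ → begin-strict
  + suc k ℚ./ 1               ≡⟨ 1+k/1 k ⟨
  1ℚ ℚ.+ + k ℚ./ 1            ≡⟨ ℚₚ.+-identityʳ _ ⟨
  (1ℚ ℚ.+ + k ℚ./ 1) ℚ.+ 0ℚ   <⟨ ℚₚ.+-monoʳ-< (1ℚ ℚ.+ + k ℚ./ 1) 0<ε ⟩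
  (1ℚ ℚ.+ + k ℚ./ 1) ℚ.+ ε    ∎
  where open ℚₚ.≤-Reasoning

fromℕ-suc≰ : ∀ k → ¬ fromℕ (suc k) ≤ᴿ fromℕ k
fromℕ-suc≰ k le =
  -- For ε = 1 the order would demand k + 1 < k + 1.
  let N , lt = le 1ℚ (toWitness {a? = 0ℚ ℚₚ.<? 1ℚ} tt)
  in ℚₚ.<-irrefl (trans (sym (1+k/1 k)) (ℚₚ.+-comm 1ℚ (+ k ℚ./ 1))) (lt N ℕₚ.≤-refl)

length≤∑ : ∀ {A : Set} (w : A → ℝ) {as} →
           All (λ a → 1ᴿ ≤ᴿ w a) as → fromℕ (length as) ≤ᴿ ∑ (map w as)
length≤∑ w []                        = ≃⇒≤ᴿ {0ᴿ} {0ᴿ} λ ε 0<ε → 0 , λ _ _ → 0<ε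
length≤∑ w {a ∷ as} (1≤a ∷ 1≤as) =
  ≤ᴿ-trans {fromℕ (suc (length as))} {1ᴿ +ᴿ fromℕ (length as)} {w a +ᴿ ∑ (map w as)}
    (fromℕ-suc (length as))
    (+ᴿ-mono-≤ᴿ {1ᴿ} {w a} {fromℕ (length as)} {∑ (map w as)} 1≤a (length≤∑ w 1≤as))

-- Bounded search and sublists.

last-before : ∀ {P : ℕ → Set} → Decidable P → P 0 → ∀ m → ¬ P m →
              ∃[ k ] k ℕ.< m × P k × ¬ P (suc k)
last-before P? P0 zero    ¬P0 = contradiction P0 ¬P0
last-before P? P0 (suc m) ¬Psm with P? m
-- The search descends, so the index just above m has already been refuted.
... | yes Pm = m , ℕₚ.≤-refl , Pm , ¬Psm
... | no ¬Pm = let k , k<m , rest = last-before P? P0 m ¬Pm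
               in k , ℕₚ.m<n⇒m<1+n k<m , rest

Unique-resp-⊆ : ∀ {A : Set} {xs ys : List A} → xs ⊆ ys → Unique ys → Unique xs
Unique-resp-⊆ []          []               = []
Unique-resp-⊆ (_ ∷ʳ τ)    (_ ∷ unique)     = Unique-resp-⊆ τ unique
Unique-resp-⊆ (refl ∷ τ)  (y∉ys ∷ unique)  = All-resp-⊆ τ y∉ys ∷ Unique-resp-⊆ τ unique

-- Walks and elementarity.

module _ {n} {G : Graph n} where
  open Graph G

  length-walkArcs : ∀ {i j ℓ} (p : Walk G i j ℓ) → length (walkArcs p) ≡ ℓ
  length-walkArcs []      = refl
  length-walkArcs (_ ∷ p) = cong suc (length-walkArcs p)

  tails : List (Arc G) → List (Fin n)
  tails = map Arc.tail

  tails⊆walkVertices : ∀ {i j ℓ} (p : Walk G i j ℓ) → tails (walkArcs p) ⊆ walkVertices p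
  tails⊆walkVertices {i} []      = i ∷ʳ []
  tails⊆walkVertices     (_ ∷ p) = refl ∷ tails⊆walkVertices p

  -- Cut the walk where it visits i. As no vertex repeats, i is the tail of no arc kept, so an arc
  -- from i to j closes the prefix to an elementary cycle.
  prefix-to : ∀ {i j k ℓ} (p : Walk G j k ℓ) → Unique (walkVertices p) → i ∈ walkVertices p →
              ∃[ m ] Σ[ q ∈ Walk G j i m ]
                walkArcs q ⊆ walkArcs p × All (i ≢_) (tails (walkArcs q))
  prefix-to []      _        (here refl) = 0 , [] , [] , []
  prefix-to (e ∷ p) _        (here refl) = 0 , [] , minimum _ , []
  prefix-to (e ∷ p) (j∉p ∷ unique) (there i∈p) =
    let m , q , q⊆p , i∉q = prefix-to p unique i∈p
    in suc m , e ∷ q , refl ∷ q⊆p , ≢-sym (All.lookup j∉p i∈p) ∷ i∉q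

  module _ {F : Arc G → Set} where

    -- Induction on the walk: if its first vertex recurred on the elementary remainder, the first
    -- arc and the part up to the recurrence would form a cycle inside `F`.
    acyclic⇒elementary :
      (∀ (C : Cycle G) → ¬ All F (Cycle.arcs C)) →
      ∀ {i j ℓ} (p : Walk G i j ℓ) → All F (walkArcs p) → Unique (walkVertices p)
    acyclic⇒elementary acyc []          _            = [] ∷ []
    acyclic⇒elementary acyc {i} (e ∷ p) (Fe ∷ Fp) =
      ¬Any⇒All¬ _ i∉p ∷ unique
      where
      unique : Unique (walkVertices p)
      unique = acyclic⇒elementary acyc p Fp

      i∉p : ¬ i ∈ walkVertices p
      i∉p i∈p =
        let _ , q , q⊆p , i∉q = prefix-to p unique i∈p
        in acyc record
             { walk       = e ∷ q
             ; elementary = i∉q ∷ Unique-resp-⊆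
                 (⊆-trans (map⁺ Arc.tail q⊆p) (tails⊆walkVertices p)) unique
             }
             (Fe ∷ All-resp-⊆ q⊆p Fp)

  -- The Gallai-Roy argument.

  module _ (F : Arc G → Set) where

    -- Vertices may repeat, so prepending an arc is always allowed and existence is decidable by
    -- recursion on the length.
    WalkFrom : Fin n → ℕ → Set
    WalkFrom i ℓ = ∃[ j ] Σ[ p ∈ Walk G i j ℓ ] All F (walkArcs p)

    module _ (F? : Decidable F) where

      arc? : ∀ i j → Dec (Σ[ e ∈ Adj i j ] F (arc i j e))
      arc? i j with T? (adj i j)
      ... | no ¬e = no (¬e ∘ proj₁)
      ... | yes e = map′ (e ,_)
        -- `F` is tested at the single proof `e`; any other adjacency proof equals it because
        -- adjacency is Boolean.
        (λ (e′ , Fe′) → subst (λ e → F (arc i j e)) (T-irrelevant e′ e) Fe′) (F? (arc i j e))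

      walkFrom? : ∀ i → Decidable (WalkFrom i)
      walkFrom? i zero    = yes (i , [] , [])
      walkFrom? i (suc ℓ) = map′
        (λ (_ , (e , Fe) , k , p , Fp) → k , e ∷ p , Fe ∷ Fp)
        (λ { (k , e ∷ p , Fe ∷ Fp) → _ , (e , Fe) , k , p , Fp })
        (any? λ j → arc? i j ×-dec walkFrom? j ℓ)

      -- The Gallai–Roy colouring: i gets a length k such that some walk of k
      -- arcs leaves i but none of k + 1 does, which an arc into i would extend.
      no-walk⇒colourable : (∀ a → F a ⊎ F (reverse a)) →
        ∀ κ → (∀ i → ¬ WalkFrom i κ) → Colourable G κ
      no-walk⇒colourable total κ no-walk =
        (λ i → fromℕ< (colour< i)) , λ i j e same →
        let ci≡cj = fromℕ<-injective _ _ (colour< i) (colour< j) same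
        in [ (λ Fij → clash (e , Fij) ci≡cj)
           , (λ Fji → clash (adj-sym e , Fji) (sym ci≡cj)) ]′ (total (arc i j e))
        where
        longest : ∀ i → ∃[ k ] k ℕ.< κ × WalkFrom i k × ¬ WalkFrom i (suc k)
        -- The empty walk gives length 0 and `no-walk` excludes κ, so every colour lies below κ.
        longest i = last-before (walkFrom? i) (i , [] , []) κ (no-walk i)

        colour : Fin n → ℕ
        colour = proj₁ ∘ longest

        colour< : ∀ i → colour i ℕ.< κ
        colour< = proj₁ ∘ proj₂ ∘ longest

        clash : ∀ {i j} → Σ[ e ∈ Adj i j ] F (arc i j e) → colour i ≢ colour j
        clash {i} {j} (e , Fe) ci≡cj =
          let _ , _ , _ , ¬longer     = longest i
              _ , _ , (k , p , Fp) , _ = longest j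
          in ¬longer (subst (WalkFrom i ∘ suc) (sym ci≡cj) (k , e ∷ p , Fe ∷ Fp))

      -- The contrapositive yields an actual walk constructively, since there are finitely many
      -- starting vertices and `walkFrom?` decides each.
      ¬colourable⇒walk : (∀ a → F a ⊎ F (reverse a)) →
        ∀ κ → ¬ Colourable G κ → ∃[ i ] WalkFrom i κ
      ¬colourable⇒walk total κ ¬colourable with any? (λ i → walkFrom? i κ)
      ... | yes walk    = walk
      ... | no  no-walk = contradiction
        (no-walk⇒colourable total κ λ i walk → no-walk (i , walk)) ¬colourable

  -- The orientation given by a feasible solution.

  module _ {κ w z} (feasible : Feasible G κ w z) where
    open Feasible feasible

    -- A lower bound is the form in which weights enter `length≤∑`; for binary weights it singles
    -- out the value 1.
    Forward : Arc G → Set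
    Forward a = 1ᴿ ≤ᴿ w a

    w≃0⇒¬forward : ∀ {a} → w a ≃ 0ᴿ → ¬ Forward a
    w≃0⇒¬forward {a} w≃0 1≤w =
      fromℕ-suc≰ 0 (≤ᴿ-trans {1ᴿ} {w a} {0ᴿ} 1≤w (≃⇒≤ᴿ {w a} {0ᴿ} w≃0))

    forward? : Decidable Forward
    -- The order on `ℝ` is not decidable in general; the disjunction in `binary` decides it here.
    forward? a with binary a
    ... | inj₁ w≃0 = no (w≃0⇒¬forward {a} w≃0)
    ... | inj₂ w≃1 = yes (≃⇒≥ᴿ {w a} {1ᴿ} w≃1)

    forward-total : ∀ a → Forward a ⊎ Forward (reverse a)
    forward-total a with binary a | binary (reverse a)
    ... | inj₂ w≃1 | _        = inj₁ (≃⇒≥ᴿ {w a} {1ᴿ} w≃1)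
    ... | inj₁ _   | inj₂ w≃1 = inj₂ (≃⇒≥ᴿ {w (reverse a)} {1ᴿ} w≃1)
    -- Two zero weights would give 1 ≤ 0 + 0, whose right side computes to 0.
    ... | inj₁ w≃0 | inj₁ w′≃0 = ⊥-elim (fromℕ-suc≰ 0
      (≤ᴿ-trans {1ᴿ} {w a +ᴿ w (reverse a)} {0ᴿ +ᴿ 0ᴿ}
        (≃⇒≥ᴿ {w a +ᴿ w (reverse a)} {1ᴿ} (orientation a))
        (+ᴿ-mono-≤ᴿ {w a} {0ᴿ} {w (reverse a)} {0ᴿ}
          (≃⇒≤ᴿ {w a} {0ᴿ} w≃0) (≃⇒≤ᴿ {w (reverse a)} {0ᴿ} w′≃0))))

    forward-acyclic : ∀ (C : Cycle G) → ¬ All Forward (Cycle.arcs C)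
    -- Exposing the first arc lets the bound, one less than the number of arcs, compute to the
    -- length of the rest, while the weights sum to at least one more.
    forward-acyclic C@record { walk = _ ∷ p } Fs = fromℕ-suc≰ (length (walkArcs p))
      (≤ᴿ-trans {fromℕ (length (Cycle.arcs C))} {∑ (map w (Cycle.arcs C))}
        {fromℕ (length (walkArcs p))} (length≤∑ w Fs) (acyclic C))

    ¬colourable⇒κ≤z : ¬ Colourable G κ → fromℕ κ ≤ᴿ z
    ¬colourable⇒κ≤z ¬colourable =
      let _ , _ , p , Fp = ¬colourable⇒walk Forward forward? forward-total κ ¬colourable
          path = record { walk = p ; elementary = acyclic⇒elementary forward-acyclic p Fp }
      in ≤ᴿ-trans {fromℕ κ} {∑ (map w (walkArcs p))} {z}
           (subst (λ ℓ → fromℕ ℓ ≤ᴿ ∑ (map w (walkArcs p))) (length-walkArcs p) (length≤∑ w Fp))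
           (pathBound path)

proposition1 : ∀ {n : ℕ} (G : Graph n) (χ : ℕ) → IsChromaticNumber G χ →
    ∀ (κ : ℕ) → 1 ≤ κ → κ ≤ χ ∸ 1 →
    ∀ (w : Arc G → ℝ) (z : ℝ) → Feasible G κ w z → z ≃ fromℕ κ
proposition1 G χ chromatic κ 1≤κ κ≤χ∸1 w z feasible =
  ≤ᴿ-antisym {z} {fromℕ κ} (Feasible.z-upper feasible)
    (¬colourable⇒κ≤z feasible (not-colourable χ (IsChromaticNumber.least chromatic κ) κ≤χ∸1))
  where
  not-colourable : ∀ χ → (Colourable G κ → χ ≤ κ) → κ ≤ χ ∸ 1 → ¬ Colourable G κ
  -- Truncated subtraction makes 0 ∸ 1 = 0, so this case is excluded by 1 ≤ κ.
  not-colourable zero    _     κ≤0 _ = ℕₚ.<⇒≱ 1≤κ κ≤0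
  not-colourable (suc χ) least κ≤χ c = ℕₚ.<⇒≱ (least c) κ≤χ
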